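{- Let $n \ge 8$ be an integer. Then the Tyler tree $\mathbb{T}_n$ of height $n$ is not long-repetition-free $2$-colorable.
   Context: In a rooted tree with root $r$, the $j$-th generation is the set of vertices at distance $j$ from $r$ (so the $0$-th generation is $\{r\}$), and the children of a vertex $v$ are the neighbours of $v$ other than the one on the path from $v$ to $r$. The Tyler tree of height $n$, denoted $\mathbb{T}_n$, is the rooted tree with root $r$ in which each vertex in the $j$-th generation has exactly $2^{n-j}+1$ children, for every $0 \le j \le n-1$, and the vertices of the $n$-th generation have no children. A word $\bar w$ is a long square if $\bar w = \bar u\bar u$ for some word $\bar u$ with $|\bar u| \ge 3$. A word is long-square-free if it contains no sub-word (that is, no block of consecutive letters) that is a long square. A simple connected graph $G=(V,E)$ is long-repetition-free $k$-colorable if there exists a coloring $\chi : V \to \{1,\dots,k\}$ (any map; adjacent vertices may receive the same color) such that for every path in $G$ with successive vertices $u_1,\dots,u_m$ (a path has pairwise distinct vertices), the word $\chi(u_1)\cdots\chi(u_m)$ is long-square-free. -}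

module Defs where

open import Data.Fin using (Fin)
open import Data.List using (List; length; map; _++_)
open import Data.List.Relation.Binary.Infix.Heterogeneous using (Infix)
open import Data.List.Relation.Unary.Linked using (Linked)
open import Data.List.Relation.Unary.Unique.Propositional using (Unique)
open import Data.Nat using (ℕ; suc; _+_; _∸_; _^_; _≤_; _<_)
open import Data.Product using (Σ; ∃; _×_; _,_)
open import Relation.Binary.Construct.Closure.ReflexiveTransitive
  using (Star; ε; _◅_; _◅◅_; reverse)
open import Relation.Binary.Construct.Closure.Symmetric
  using (SymClosure; fwd; bwd; symmetric)
open import Relation.Binary.Definitions using (Symmetric; Irreflexive)
open import Relation.Binary.PropositionalEquality using (_≡_; refl)
open import Relation.Nullary using (¬_)

Word : Set → Set
Word A = List A

LongSquare : {A : Set} → Word A → Set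
LongSquare w = ∃ λ u → 3 ≤ length u × w ≡ u ++ u

-- `Infix _≡_ v w` says that v is a block of consecutive letters of w.
LongSquareFree : {A : Set} → Word A → Set
LongSquareFree w = ∀ v → Infix _≡_ v w → ¬ LongSquare v

record SimpleConnectedGraph : Set₁ where
  field
    Vertex    : Set
    Adj       : Vertex → Vertex → Set
    sym       : Symmetric Adj
    irrefl    : Irreflexive _≡_ Adj
    connected : ∀ u v → Star Adj u v

module _ (G : SimpleConnectedGraph) where
  open SimpleConnectedGraph G

  IsPath : List Vertex → Set
  IsPath us = Linked Adj us × Unique us

  LongRepetitionFreeColorable : ℕ → Set
  LongRepetitionFreeColorable k =
    Σ (Vertex → Fin k) λ χ → ∀ us → IsPath us → LongSquareFree (map χ us)

module Tyler (n : ℕ) where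

  -- `Generation j` is the set of vertices at distance j from the root.  A vertex
  -- other than the root is given by its parent and its position among the
  -- parent's children; since j < n is required (irrelevantly, so that it adds
  -- no further vertices), vertices of generation n have no children.
  data Generation : ℕ → Set where
    root  : Generation 0
    child : ∀ {j} → .(j < n) → Generation j → Fin (2 ^ (n ∸ j) + 1) →
            Generation (suc j)

  Vertex : Set
  Vertex = Σ ℕ Generation

  data ParentOf : Vertex → Vertex → Set where
    parent : ∀ {j} .(j<n : j < n) (v : Generation j) (i : Fin (2 ^ (n ∸ j) + 1)) →
             ParentOf (j , v) (suc j , child j<n v i)

  Adj : Vertex → Vertex → Set
  Adj = SymClosure ParentOf

  ParentOf-irrefl : ∀ {v} → ¬ ParentOf v v
  ParentOf-irrefl ()

  Adj-irrefl : Irreflexive _≡_ Adj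
  Adj-irrefl refl (fwd p) = ParentOf-irrefl p
  Adj-irrefl refl (bwd p) = ParentOf-irrefl p

  toRoot : ∀ {j} (v : Generation j) → Star Adj (j , v) (0 , root)
  toRoot root            = ε
  toRoot (child j<n v i) = bwd (parent j<n v i) ◅ toRoot v

  Adj-connected : ∀ u v → Star Adj u v
  Adj-connected (_ , u) (_ , v) =
    toRoot u ◅◅ reverse (symmetric ParentOf) (toRoot v)

TylerTree : ℕ → SimpleConnectedGraph
TylerTree n = record
  { Vertex    = Vertex
  ; Adj       = Adj
  ; sym       = symmetric ParentOf
  ; irrefl    = Adj-irrefl
  ; connected = Adj-connected
  }
  where open Tyler n

{-# OPTIONS --safe #-}

-- From the leaves upwards, every vertex at height m is the root of a binary
-- subtree of height m coloured level by level: each of its 2 ^ m + 1 children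
-- has such a subtree, with one of 2 ^ m words, so two children share a word.
-- In a level-coloured binary tree with word w, every suffix x ∷ v of w yields
-- the palindrome reverse v ++ x ∷ v along a path that turns at the level of x.
-- No binary word of length at least 9 has all these palindromes
-- long-square-free; this is a small finite search over words of length at most 9.
module Submission where

open import Defs
open import Data.Fin using (Fin; funToFin; finToFun)
open import Data.Fin.Properties using (_≟_; <⇒≢; pigeonhole; finToFun-funToFin)
open import Data.List
  using (List; []; _∷_; _++_; _ʳ++_; allFin; cartesianProductWith; filter; length; map; tails; take; upTo)
open import Data.List.Membership.Propositional using (_∈_)
open import Data.List.Membership.Propositional.Properties
  using (∈-allFin; ∈-cartesianProductWith⁺; ∈-filter⁺)
open import Data.List.Properties using (map-ʳ++)
open import Data.List.Relation.Binary.Infix.Heterogeneous using (here; there)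
open import Data.List.Relation.Binary.Prefix.Heterogeneous using (Prefix)
open import Data.List.Relation.Binary.Prefix.Heterogeneous.Properties using (prefix?)
open import Data.List.Relation.Unary.All as All using (All; []; _∷_)
open import Data.List.Relation.Unary.AllPairs using (AllPairs; []; _∷_)
open import Data.List.Relation.Unary.Any as Any using (Any; here; there; any?)
open import Data.List.Relation.Unary.Linked using (Linked; []; [-]; _∷_)
open import Data.List.Relation.Unary.Unique.Propositional using (Unique)
open import Data.Nat using (ℕ; zero; suc; _+_; _∸_; _^_; _≤_; _<_; _≤?_; s≤s)
open import Data.Nat.Properties
  using (≤-refl; ≤-reflexive; <-irrefl; m≤n⇒m≤1+n; m≤n+m; m+n∸n≡m; m∸n+n≡m; +-comm; +-identityʳ; +-suc)
open import Data.Product using (∃; _×_; _,_; proj₁; proj₂)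
open import Data.Vec using (Vec; []; _∷_; lookup; toList; tabulate)
open import Data.Vec.Properties using (length-toList; tabulate-cong; tabulate∘lookup)
open import Function using (_∘_)
open import Relation.Binary using (Symmetric)
open import Relation.Binary.Construct.Closure.Symmetric using (fwd; symmetric)
open import Relation.Binary.PropositionalEquality
  using (_≡_; _≢_; refl; sym; trans; cong; subst; ≢-sym; module ≡-Reasoning)
open import Relation.Nullary using (¬_; ¬?; _×-dec_)
open import Relation.Unary using (Decidable)

-- Long squares and the finite search

module _ {A : Set} where

  LongSquarePrefix : Word A → ℕ → Set
  LongSquarePrefix w m =
    3 ≤ length (take m w) × Prefix _≡_ (take m w ++ take m w) w

  HasLongSquare : Word A → Set
  HasLongSquare w = Any (λ v → Any (LongSquarePrefix v) (upTo (length v))) (tails w)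

  -- Guarantees that the search rejects a word only for a genuine long square.
  hasLongSquare-sound : ∀ w → HasLongSquare w → ¬ LongSquareFree w
  hasLongSquare-sound w (here p) free with Any.satisfied p
  ... | m , long , prefix = free _ (here prefix) (take m w , long , refl)
  hasLongSquare-sound (x ∷ w) (there p) free =
    hasLongSquare-sound w p (λ v v⊆w → free v (there v⊆w))

  palindrome : Word A → Word A
  palindrome []      = []
  palindrome (x ∷ w) = w ʳ++ (x ∷ w)

  Admissible : Word A → Set
  Admissible w = All (LongSquareFree ∘ palindrome) (tails w)

hasLongSquare? : ∀ {k} → Decidable (HasLongSquare {Fin k})
hasLongSquare? w =
  any? (λ v → any? (λ m → (3 ≤? length (take m v)) ×-dec prefix? _≟_ _ v) (upTo (length v)))
       (tails w)

-- Prepending letters one at a time keeps the search small: a word is extended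
-- only if all palindromes of its suffixes passed the test.
candidates : ℕ → List (Word (Fin 2))
candidates zero    = [] ∷ []
candidates (suc m) =
  filter (¬? ∘ hasLongSquare? ∘ palindrome)
         (cartesianProductWith _∷_ (allFin 2) (candidates m))

-- Completeness of the search: if the filter rejected an extension, its palindrome would contain a
-- long square, against `free`.
admissible⇒candidate : ∀ w → Admissible w → w ∈ candidates (length w)
admissible⇒candidate []      _            = here refl
admissible⇒candidate (x ∷ w) (free ∷ adm) =
  ∈-filter⁺ (¬? ∘ hasLongSquare? ∘ palindrome)
    (∈-cartesianProductWith⁺ _∷_ (∈-allFin x) (admissible⇒candidate w adm))
    (λ p → hasLongSquare-sound _ p free)

candidates-empty : ∀ m → candidates (m + 9) ≡ []
-- Evaluating the search shows that no word of length 9 survives.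
candidates-empty zero    = refl
candidates-empty (suc m) rewrite candidates-empty m = refl

long⇒¬admissible : ∀ w → 9 ≤ length w → ¬ Admissible w
long⇒¬admissible w long adm
  with () ← subst (w ∈_)
              (subst (λ m → candidates m ≡ []) (m∸n+n≡m long) (candidates-empty (length w ∸ 9)))
              (admissible⇒candidate w adm)

-- Joining lists at a turning point

module _ {A : Set} {R : A → A → Set} (R-sym : Symmetric R) where

  -- The shared head `x` is the turning point: the first list is walked backwards to `x`, then the
  -- second forwards.
  linked-ʳ++ : ∀ {x xs ys} → Linked R (x ∷ xs) → Linked R (x ∷ ys) → Linked R (xs ʳ++ (x ∷ ys))
  linked-ʳ++ [-]      l = l
  linked-ʳ++ (r ∷ rs) l = linked-ʳ++ rs (R-sym r ∷ l)

  allPairs-ʳ++ : ∀ {xs ys} → AllPairs R xs → AllPairs R ys → All (λ x → All (R x) ys) xs →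
                 AllPairs R (xs ʳ++ ys)
  allPairs-ʳ++ []       qs []       = qs
  allPairs-ʳ++ (p ∷ ps) qs (r ∷ rs) =
    allPairs-ʳ++ ps (r ∷ qs) (All.zipWith (λ (a , b) → R-sym a ∷ b) (p , rs))

-- Numbers the words, so that `pigeonhole` on `Fin` can find two equal ones.
encode : ∀ {k m} → Vec (Fin k) m → Fin (k ^ m)
encode = funToFin ∘ lookup

encode-injective : ∀ {k m} (v w : Vec (Fin k) m) → encode v ≡ encode w → v ≡ w
encode-injective v w eq = begin
  v                              ≡⟨ tabulate∘lookup v ⟨
  tabulate (lookup v)            ≡⟨ tabulate-cong (finToFun-funToFin (lookup v)) ⟨
  tabulate (finToFun (encode v)) ≡⟨ cong (tabulate ∘ finToFun) eq ⟩
  tabulate (finToFun (encode w)) ≡⟨ tabulate-cong (finToFun-funToFin (lookup w)) ⟩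
  tabulate (lookup w)            ≡⟨ tabulate∘lookup w ⟩
  w                              ∎
  where open ≡-Reasoning

-- Descendants and level-coloured subtrees

module _ (n : ℕ) where
  open Tyler n

  data _≼_ {j} (v : Generation j) : Vertex → Set where
    ≼-refl : v ≼ (j , v)
    ≼-step : ∀ {k u} .{k<n : k < n} {i} → v ≼ (k , u) → v ≼ (suc k , child k<n u i)

  ≼⇒≤ : ∀ {j} {v : Generation j} {u} → v ≼ u → j ≤ proj₁ u
  ≼⇒≤ ≼-refl     = ≤-refl
  ≼⇒≤ (≼-step p) = m≤n⇒m≤1+n (≼⇒≤ p)

  child-≼⇒≼ : ∀ {j} .{j<n : j < n} {v i u} → child j<n v i ≼ u → v ≼ u
  child-≼⇒≼ ≼-refl     = ≼-step ≼-refl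
  child-≼⇒≼ (≼-step p) = ≼-step (child-≼⇒≼ p)

  child-≼⇒≢ : ∀ {j} .{j<n : j < n} {v i u} → child j<n v i ≼ u → (j , v) ≢ u
  child-≼⇒≢ p refl = <-irrefl refl (≼⇒≤ p)

  -- Both chains climb from `u` one generation at a time and so reach generation `j` together; in
  -- the mixed cases an ancestor would lie in a later generation than its descendant.
  ancestor-unique : ∀ {j} {v v′ : Generation j} {u} → v ≼ u → v′ ≼ u → v ≡ v′
  ancestor-unique ≼-refl     ≼-refl     = refl
  ancestor-unique ≼-refl     (≼-step q) with () ← <-irrefl refl (≼⇒≤ q)
  ancestor-unique (≼-step p) ≼-refl     with () ← <-irrefl refl (≼⇒≤ p)
  ancestor-unique (≼-step p) (≼-step q) = ancestor-unique p q

  siblings-disjoint : ∀ {j} .{j<n : j < n} {v i i′ u u′} → i ≢ i′ →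
                      child j<n v i ≼ u → child j<n v i′ ≼ u′ → u ≢ u′
  siblings-disjoint i≢i′ p q refl with refl ← ancestor-unique p q = i≢i′ refl

  module _ {k} (χ : Vertex → Fin k) where

    -- The field `descends` keeps the path below `v`, which makes paths under distinct siblings
    -- disjoint.
    record Descent {j} (v : Generation j) (w : Word (Fin k)) : Set where
      constructor descent
      field
        {below}  : List Vertex
        colours  : map χ ((j , v) ∷ below) ≡ w
        linked   : Linked Adj ((j , v) ∷ below)
        unique   : Unique ((j , v) ∷ below)
        descends : All (v ≼_) ((j , v) ∷ below)

    stop : ∀ {j} (v : Generation j) → Descent v (χ (j , v) ∷ [])
    stop v = descent refl [-] ([] ∷ []) (≼-refl ∷ [])

    descend : ∀ {j} .{j<n : j < n} {v i w} → Descent (child j<n v i) w → Descent v (χ (j , v) ∷ w)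
    descend {j<n = j<n} {v} {i} (descent eq l u d) =
      descent (cong (_ ∷_) eq) (fwd (parent j<n v i) ∷ l) (All.map child-≼⇒≢ d ∷ u)
              (≼-refl ∷ All.map child-≼⇒≼ d)

    -- A binary subtree in which all vertices of one generation share a colour;
    -- the word lists these colours from the top down.
    data LevelColoured {j} (v : Generation j) : ∀ {m} → Vec (Fin k) m → Set where
      leaf : LevelColoured v (χ (j , v) ∷ [])
      node : ∀ {m} {w : Vec (Fin k) m} .(j<n : j < n) {i i′} → i ≢ i′ →
             LevelColoured (child j<n v i) w → LevelColoured (child j<n v i′) w →
             LevelColoured v (χ (j , v) ∷ w)

    levelColoured⇒descent : ∀ {j} {v : Generation j} {m} {w : Vec (Fin k) m} →
                            LevelColoured v w → Descent v (toList w)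
    levelColoured⇒descent leaf           = stop _
    levelColoured⇒descent (node _ _ t _) = descend (levelColoured⇒descent t)

    module _ (free : ∀ us → IsPath (TylerTree n) us → LongSquareFree (map χ us)) where

      -- The path climbs the first descent from its bottom to `v`, then follows the second; both
      -- descents spell `w`.
      palindrome-free : ∀ {j} .{j<n : j < n} {v i i′ w} → i ≢ i′ →
                        Descent (child j<n v i) w → Descent (child j<n v i′) w →
                        LongSquareFree (palindrome (χ (j , v) ∷ w))
      palindrome-free {j} {j<n} {v} {i} {i′} i≢i′ D@(descent {us} refl _ u d) D′@(descent {us′} eq _ _ d′) =
        subst LongSquareFree word (free _ (linked , unique))
        where
        up down : List Vertex
        up   = (_ , child j<n v i) ∷ us
        down = (_ , child j<n v i′) ∷ us′

        linked : Linked Adj (up ʳ++ ((j , v) ∷ down))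
        linked = linked-ʳ++ (symmetric ParentOf) (Descent.linked (descend D)) (Descent.linked (descend D′))

        unique : Unique (up ʳ++ ((j , v) ∷ down))
        unique = allPairs-ʳ++ ≢-sym u (Descent.unique (descend D′))
          -- A vertex of `up` differs from `v` by its generation and from those of `down` by its
          -- branch.
          (All.map (λ p → ≢-sym (child-≼⇒≢ p) ∷ All.map (siblings-disjoint i≢i′ p) d′) d)

        word : map χ (up ʳ++ ((j , v) ∷ down)) ≡ palindrome (χ (j , v) ∷ map χ up)
        word = trans (map-ʳ++ χ up) (cong (λ w → map χ up ʳ++ (χ (j , v) ∷ w)) eq)

      levelColoured⇒admissible : ∀ {j} {v : Generation j} {m} {w : Vec (Fin k) m} →
                                 LevelColoured v w → Admissible (toList w)
      levelColoured⇒admissible leaf =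
        -- The suffixes of a one-letter word come from a one-vertex path and the empty path.
        free _ ([-] , [] ∷ []) ∷ free [] ([] , []) ∷ []
      levelColoured⇒admissible (node _ i≢i′ t t′) =
        palindrome-free i≢i′ (levelColoured⇒descent t) (levelColoured⇒descent t′) ∷
        -- Proper suffixes are suffixes of the child's word, so one child's subtree handles them
        -- all.
        levelColoured⇒admissible t

  levelColoured : (χ : Vertex → Fin 2) → ∀ m {j} → m + j ≡ n → (v : Generation j) →
                  ∃ λ (w : Vec (Fin 2) (suc m)) → LevelColoured χ v w
  levelColoured χ zero        eq v = _ , leaf
  levelColoured χ (suc m) {j} eq v =
    let i , i′ , i<i′ , same = pigeonhole few (encode ∘ proj₁ ∘ subtree) in
    _ , node j<n (<⇒≢ i<i′) (proj₂ (subtree i))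
      (subst (LevelColoured χ _) (sym (encode-injective _ _ same)) (proj₂ (subtree i′)))
    where
    j<n : j < n
    j<n = subst (j <_) eq (s≤s (m≤n+m j m))

    subtree : ∀ i → ∃ λ (w : Vec (Fin 2) (suc m)) → LevelColoured χ (child j<n v i) w
    subtree i = levelColoured χ m (trans (+-suc m j) eq) (child j<n v i)

    few : 2 ^ suc m < 2 ^ (n ∸ j) + 1
    few = ≤-reflexive (begin
      suc (2 ^ suc m)         ≡⟨ +-comm 1 (2 ^ suc m) ⟩
      2 ^ suc m + 1           ≡⟨ cong (λ d → 2 ^ d + 1) (m+n∸n≡m (suc m) j) ⟨
      2 ^ (suc m + j ∸ j) + 1 ≡⟨ cong (λ d → 2 ^ (d ∸ j) + 1) eq ⟩
      2 ^ (n ∸ j) + 1         ∎)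
      where open ≡-Reasoning

proposition3p4 : ∀ (n : ℕ) → 8 ≤ n → ¬ LongRepetitionFreeColorable (TylerTree n) 2
proposition3p4 n 8≤n (χ , free) =
  let w , t = levelColoured n χ n (+-identityʳ n) Tyler.root in
  -- Generations 0 to `n` give the word `n + 1` letters, hence at least 9.
  long⇒¬admissible (toList w) (subst (9 ≤_) (sym (length-toList w)) (s≤s 8≤n))
    (levelColoured⇒admissible n χ free t)
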